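{- Let $G=(V,E)$ and $H=(U,F)$ be finite simple graphs, each with $n$ vertices. Then the uniqueness tree algorithm (tree generation stage followed by tree comparison stage, as described in the context) applied to $G$ and $H$ runs in time $O(n^7)$ in the worst case.
   Context: A simple graph is a finite, unweighted, undirected graph with no loops or multiple edges; the size $n$ of a graph is its number of vertices. The uniqueness tree algorithm, applied to two graphs $G=(V,E)$ and $H=(U,F)$ of size $n$, consists of two stages. Tree generation stage: for each graph and each vertex $v$ of it, build a rooted tree $T(v)$ whose nodes are labelled by vertices of the graph, level by level. Level $0$ consists of the root, labelled $v$. Given the current level, a node of that level is called unique if its label occurs exactly once among the labels of the nodes of that level. Each non-unique node becomes a leaf (no children); each unique node labelled $u$ receives one child for each neighbour $w$ of $u$ in the graph, labelled $w$; these children form the next level. This is repeated while some node on the current level is unique and the height of $T(v)$ is less than $n$. Tree comparison stage: initially no vertex is mapped. For each unmapped $v\in V$ and, in turn, each unmapped $u\in U$, declare $v$ and $u$ equivalent unless one of the following holds: the heights of $T(v)$ and $T(u)$ differ; for some level, the numbers of nodes on that level of $T(v)$ and $T(u)$ differ; for some level and some $i\in\{1,\dots,n-1\}$, the number of nodes on that level having exactly $i$ children differs between $T(v)$ and $T(u)$. If $v$ and $u$ are equivalent, mark both as mapped (map $v$ onto $u$). At the end, output "$G\cong H$" if all vertices of $V$ and $U$ have been mapped, and "$G\not\cong H$" otherwise. -}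

module Defs where

open import Data.Bool.Base using (Bool; true; false; if_then_else_)
open import Data.Fin.Base using (Fin)
import Data.Fin.Properties as Fin
open import Data.List.Base as List using (List; []; _∷_)
open import Data.Nat.Base as ℕ using (ℕ; zero; suc; _+_)
import Data.Nat.Properties as ℕ
open import Data.Product.Base using (_×_; _,_; proj₁; proj₂)
open import Relation.Binary.PropositionalEquality.Core using (_≡_)
open import Relation.Nullary.Decidable.Core using (⌊_⌋)

record Graph (n : ℕ) : Set where
  field
    adjacent    : Fin n → Fin n → Bool
    symmetric   : ∀ u v → adjacent u v ≡ adjacent v u
    irreflexive : ∀ v → adjacent v v ≡ false

open Graph public

------------------------------------------------------------------------
-- Algorithms are written as terms of a small language, and every construct
-- is charged one unit each time it is evaluated, so that no computation
-- escapes the count. Each construct, apart from the evaluation of its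
-- subterms, is a constant-time operation of a random-access machine:
-- lists and pairs are pointers to immutable cells, and numbers (which in
-- the program below stay polynomial in the size of the input) fit in a
-- machine word. The input is a pair of graphs on the same number of vertices,
-- given by adjacency matrices.

data Ty : Set where
  bool nat vertex : Ty
  list            : Ty → Ty
  _⊗_             : Ty → Ty → Ty

infixr 6 _⊗_

data Side : Set where
  left right : Side

-- Parametric higher-order syntax: V is the type of variables. A program is
-- a term that is polymorphic in V, hence it can inspect data only through the
-- constructs of the language; it does not depend on the size of the
-- input either.

data Tm (V : Ty → Set) : Ty → Set where
  var      : ∀ {σ} → V σ → Tm V σ
  bind     : ∀ {σ τ} → Tm V σ → (V σ → Tm V τ) → Tm V τ

  tt ff    : Tm V bool
  cond     : ∀ {τ} → Tm V bool → Tm V τ → Tm V τ → Tm V τ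

  zer      : Tm V nat
  succ     : Tm V nat → Tm V nat
  prd      : Tm V nat → Tm V nat
  _==_     : Tm V nat → Tm V nat → Tm V bool

  _==ᵛ_    : Tm V vertex → Tm V vertex → Tm V bool

  -- The input: the number of vertices, the list of all vertices, and
  -- the entries of the two adjacency matrices.
  size     : Tm V nat
  vertices : Tm V (list vertex)
  adj      : Side → Tm V vertex → Tm V vertex → Tm V bool

  pair     : ∀ {σ τ} → Tm V σ → Tm V τ → Tm V (σ ⊗ τ)
  fst      : ∀ {σ τ} → Tm V (σ ⊗ τ) → Tm V σ
  snd      : ∀ {σ τ} → Tm V (σ ⊗ τ) → Tm V τ

  nil      : ∀ {σ} → Tm V (list σ)
  cons     : ∀ {σ} → Tm V σ → Tm V (list σ) → Tm V (list σ)
  match    : ∀ {σ τ} → Tm V (list σ) →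
             Tm V τ → (V σ → V (list σ) → Tm V τ) → Tm V τ

  -- for each element of the list, from first to last, update the state
  forEach  : ∀ {σ τ} → Tm V (list σ) → Tm V τ → (V τ → V σ → Tm V τ) → Tm V τ
  -- for i = 0, …, k − 1, update the state
  forUpTo  : ∀ {τ} → Tm V nat → Tm V τ → (V τ → V nat → Tm V τ) → Tm V τ
  -- update the state while the condition holds, at most k times
  while    : ∀ {τ} → Tm V nat → Tm V τ →
             (V τ → Tm V bool) → (V τ → Tm V τ) → Tm V τ

infix  5 _==_ _==ᵛ_
infixr 2 bind

syntax bind e (λ x → b) = x ← e ⨾ b

whileVal : {S : Set} → ℕ → (S → Bool) → (S → S) → S → S
whileVal zero    c f s = s
whileVal (suc k) c f s = if c s then whileVal k c f (f s) else s

forEachCost : {S A : Set} → (S → A → S) → (S → A → ℕ) → S → List A → ℕ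
forEachCost f t s []       = 0
forEachCost f t s (x ∷ xs) = suc (t s x + forEachCost f t (f s x) xs)

whileCost : {S : Set} → ℕ → (S → Bool) → (S → ℕ) →
            (S → S) → (S → ℕ) → S → ℕ
whileCost zero    c tc f tf s = 0
whileCost (suc k) c tc f tf s =
  suc (tc s + (if c s then tf s + whileCost k c tc f tf (f s) else 0))

⟦_⟧ : Ty → ℕ → Set
⟦ bool   ⟧ n = Bool
⟦ nat    ⟧ n = ℕ
⟦ vertex ⟧ n = Fin n
⟦ list σ ⟧ n = List (⟦ σ ⟧ n)
⟦ σ ⊗ τ  ⟧ n = ⟦ σ ⟧ n × ⟦ τ ⟧ n

Val : ℕ → Ty → Set
Val n σ = ⟦ σ ⟧ n

module Evaluation {n : ℕ} (G H : Graph n) where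

  matchVal : {A B : Set} → List A → B → (A → List A → B) → B
  matchVal []       b f = b
  matchVal (x ∷ xs) b f = f x xs

  graph : Side → Graph n
  graph left  = G
  graph right = H

  val : ∀ {τ} → Tm (Val n) τ → Val n τ
  val (var x)         = x
  val (bind e k)      = val (k (val e))
  val tt              = true
  val ff              = false
  val (cond b e e′)   = if val b then val e else val e′
  val zer             = 0
  val (succ e)        = suc (val e)
  val (prd e)         = ℕ.pred (val e)
  val (e == e′)       = ⌊ val e ℕ.≟ val e′ ⌋
  val (e ==ᵛ e′)      = ⌊ val e Fin.≟ val e′ ⌋
  val size            = n
  val vertices        = List.allFin n
  val (adj s e e′)    = adjacent (graph s) (val e) (val e′)
  val (pair e e′)     = val e , val e′
  val (fst e)         = proj₁ (val e)
  val (snd e)         = proj₂ (val e)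
  val nil             = []
  val (cons e e′)     = val e ∷ val e′
  val (match e z k)   = matchVal (val e) (val z) (λ x xs → val (k x xs))
  val (forEach e z k) = List.foldl (λ s x → val (k s x)) (val z) (val e)
  val (forUpTo e z k) = List.foldl (λ s i → val (k s i)) (val z) (List.upTo (val e))
  val (while e z c k) = whileVal (val e) (λ s → val (c s)) (λ s → val (k s)) (val z)

  cost : ∀ {τ} → Tm (Val n) τ → ℕ
  cost (var x)         = 1
  cost (bind e k)      = 1 + cost e + cost (k (val e))
  cost tt              = 1
  cost ff              = 1
  cost (cond b e e′)   = 1 + cost b + (if val b then cost e else cost e′)
  cost zer             = 1
  cost (succ e)        = 1 + cost e
  cost (prd e)         = 1 + cost e
  cost (e == e′)       = 1 + cost e + cost e′
  cost (e ==ᵛ e′)      = 1 + cost e + cost e′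
  cost size            = 1
  cost vertices        = 1
  cost (adj s e e′)    = 1 + cost e + cost e′
  cost (pair e e′)     = 1 + cost e + cost e′
  cost (fst e)         = 1 + cost e
  cost (snd e)         = 1 + cost e
  cost nil             = 1
  cost (cons e e′)     = 1 + cost e + cost e′
  cost (match e z k)   = 1 + cost e + matchVal (val e) (cost z) (λ x xs → cost (k x xs))
  cost (forEach e z k) = 1 + cost e + cost z +
    forEachCost (λ s x → val (k s x)) (λ s x → cost (k s x)) (val z) (val e)
  cost (forUpTo e z k) = 1 + cost e + cost z +
    forEachCost (λ s i → val (k s i)) (λ s i → cost (k s i)) (val z) (List.upTo (val e))
  cost (while e z c k) = 1 + cost e + cost z +
    whileCost (val e) (λ s → val (c s)) (λ s → cost (c s))
                      (λ s → val (k s)) (λ s → cost (k s)) (val z)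

------------------------------------------------------------------------
-- A node is its label together with the labels of its children, and a tree is
-- the list of its levels, deepest level first. The nodes of each level are,
-- in order, the children of the nodes of the level above it.

node level tree : Ty
node  = vertex ⊗ list vertex
level = list node
tree  = list level

module Program {V : Ty → Set} where

  infixr 3 _and_

  _and_ : Tm V bool → Tm V bool → Tm V bool
  b and c = cond b c ff

  length : ∀ {σ} → Tm V (list σ) → Tm V nat
  length xs = forEach xs zer (λ k _ → succ (var k))

  occurrences : V vertex → V (list vertex) → Tm V nat
  occurrences u us =
    forEach (var us) zer (λ k w → cond (var w ==ᵛ var u) (succ (var k)) (var k))

  member : V vertex → Tm V (list vertex) → Tm V bool
  member u us = forEach us ff (λ b w → cond (var w ==ᵛ var u) tt (var b))

  reverse : ∀ {σ} → Tm V (list σ) → Tm V (list σ)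
  reverse xs = forEach xs nil (λ ys x → cons (var x) (var ys))

  neighbours : Side → V vertex → Tm V (list vertex)
  neighbours s u = forEach vertices nil λ ws w →
    cond (adj s (var u) (var w)) (cons (var w) (var ws)) (var ws)

  -- Levels under construction are represented by the labels of their nodes.

  unique : V vertex → V (list vertex) → Tm V bool
  unique u us = occurrences u us == succ zer

  someUnique : V (list vertex) → Tm V bool
  someUnique us = forEach (var us) ff λ b u → cond (unique u us) tt (var b)

  expand : Side → V (list vertex) → Tm V level
  expand s us = forEach (var us) nil λ ns u →
    cons (pair (var u) (cond (unique u us) (neighbours s u) nil)) (var ns)

  childLabels : V level → Tm V (list vertex)
  childLabels l = forEach (var l) nil λ ws x →
    forEach (snd (var x)) (var ws) λ ws′ w → cons (var w) (var ws′)

  leaves : V (list vertex) → Tm V level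
  leaves us = forEach (var us) nil λ ns u → cons (pair (var u) nil) (var ns)

  -- The state consists of the levels completed so far and of the current level.
  -- Each iteration increases the height by one, hence the bound on the number
  -- of iterations is the condition that the height is less than n. (The only
  -- exception is an isolated root: then the new level is empty, there is no
  -- further iteration, and the empty level is discarded.)

  generateTree : Side → V vertex → Tm V tree
  generateTree s v =
    st ← while size (pair nil (cons (var v) nil))
           (λ st → us ← snd (var st) ⨾ someUnique us)
           (λ st → us ← snd (var st) ⨾
                   l  ← expand s us ⨾
                   pair (cons (var l) (fst (var st))) (childLabels l)) ⨾
    us ← snd (var st) ⨾
    match (var us)
      (fst (var st))
      (λ _ _ → cons (leaves us) (fst (var st)))

  generateTrees : Side → Tm V (list (vertex ⊗ tree))
  generateTrees s =
    vs ← reverse vertices ⨾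
    forEach (var vs) nil λ ts v → cons (pair (var v) (generateTree s v)) (var ts)

  withChildren : V nat → V level → Tm V nat
  withChildren i l = forEach (var l) zer λ k x →
    cond (length (snd (var x)) == var i) (succ (var k)) (var k)

  sameLevel : V level → V level → Tm V bool
  sameLevel l m =
    (length (var l) == length (var m)) and
    forUpTo (prd size) tt (λ b j →
      i ← succ (var j) ⨾
      var b and (withChildren i l == withChildren i m))

  -- For trees of the same height; the state consists of the levels of the
  -- second tree that remain to be compared and of the answer so far.

  sameLevels : V tree → V tree → Tm V bool
  sameLevels t t′ = snd (forEach (var t) (pair (var t′) tt) λ st l →
    match (fst (var st))
      (pair nil ff)
      (λ m ms → pair (var ms) (snd (var st) and sameLevel l m)))

  equivalent : V tree → V tree → Tm V bool
  equivalent t t′ = (length (var t) == length (var t′)) and sameLevels t t′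

  -- The state consists of the mapped vertices of each of the two graphs.

  compareTrees : V (list (vertex ⊗ tree)) → V (list (vertex ⊗ tree)) →
                 Tm V (list vertex ⊗ list vertex)
  compareTrees ts ts′ =
    forEach (var ts) (pair nil nil) λ st₀ x →
      forEach (var ts′) (var st₀) λ st y →
        v ← fst (var x) ⨾
        u ← fst (var y) ⨾
        t ← snd (var x) ⨾
        t′ ← snd (var y) ⨾
        cond (member v (fst (var st))) (var st)
          (cond (member u (snd (var st))) (var st)
            (cond (equivalent t t′)
              (pair (cons (var v) (fst (var st))) (cons (var u) (snd (var st))))
              (var st)))

  allVertices : V (list vertex) → Tm V bool
  allVertices us = forEach vertices tt λ b v → var b and member v (var us)

  -- The answer is true for "G ≅ H", and false for "G ≇ H".

  uniquenessTree : Tm V bool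
  uniquenessTree =
    ts ← generateTrees left ⨾
    ts′ ← generateTrees right ⨾
    st ← compareTrees ts ts′ ⨾
    vs ← fst (var st) ⨾
    us ← snd (var st) ⨾
    allVertices vs and allVertices us

open Program public using (uniquenessTree)

answer : ∀ {n} → Graph n → Graph n → Bool
answer G H = Evaluation.val G H uniquenessTree

runningTime : ∀ {n} → Graph n → Graph n → ℕ
runningTime G H = Evaluation.cost G H uniquenessTree

{-# OPTIONS --safe #-}
module Submission where

-- A level contains at most n unique nodes, since these have distinct labels, and each
-- of them has at most n children; hence every level has at most n² nodes. Testing
-- uniqueness therefore costs O(n²) per node, O(n⁴) per level, O(n⁵) per tree and
-- O(n⁶) in total. In the comparison, counting the nodes of a level with i children
-- costs O(n³), since measuring one list of children costs O(n); over all i, the O(n)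
-- levels and the n² pairs of trees this is O(n⁷).

open import Defs
open import Data.Bool.Base using (Bool; true; false; if_then_else_)
open import Data.Fin.Base using (Fin; zero; suc)
import Data.Fin.Properties as Fin
open import Data.List.Base using (List; []; _∷_; length; lookup; filter; foldl; map; allFin)
open import Data.List.Properties using (length-tabulate; length-upTo; filter-accept; filter-reject)
open import Data.List.Relation.Unary.All as All using (All; []; _∷_)
import Data.List.Relation.Unary.All.Properties as All
open import Data.List.Relation.Unary.Unique.Propositional using (Unique; []; _∷_)
open import Data.List.Membership.Propositional.Properties using (∈-lookup)
open import Data.Nat.Base using (ℕ; zero; suc; _+_; _*_; _^_; _⊔_; _≤_; z≤n; s≤s; NonZero; >-nonZero)
open import Data.Nat.ListAction using (sum)
open import Data.Nat.Properties
open import Data.Product.Base using (∃-syntax; _×_; _,_; proj₁; proj₂)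
open import Data.Unit.Base using (⊤)
open import Function.Base using (_∘_)
open import Function.Definitions using (Injective)
open import Relation.Binary.PropositionalEquality using (_≡_; _≢_; refl; sym; trans; cong; subst)
open import Relation.Nullary using (yes; no; contradiction; Dec)
open import Relation.Nullary.Decidable using (⌊_⌋)

-- Lists without repetition, and labels that occur exactly once.

lookup-injective : {A : Set} {xs : List A} → Unique xs → Injective _≡_ _≡_ (lookup xs)
lookup-injective (x∉xs ∷ _)  {zero}  {zero}  _  = refl
lookup-injective (x∉xs ∷ _)  {zero}  {suc j} eq = contradiction eq (All.lookup x∉xs (∈-lookup j))
lookup-injective (x∉xs ∷ _)  {suc i} {zero}  eq = contradiction (sym eq) (All.lookup x∉xs (∈-lookup i))
lookup-injective (_ ∷ xs!)   {suc i} {suc j} eq = cong suc (lookup-injective xs! eq)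

-- Pigeonhole: `lookup` embeds the positions injectively into `Fin n`.
Unique⇒length≤ : ∀ {n} {us : List (Fin n)} → Unique us → length us ≤ n
Unique⇒length≤ us! = Fin.injective⇒≤ (lookup-injective us!)

count : ∀ {n} → Fin n → List (Fin n) → ℕ
count u us = length (filter (Fin._≟ u) us)

count≤0⇒∉ : ∀ {n} {u : Fin n} us → count u us ≤ 0 → All (u ≢_) us
count≤0⇒∉ []       _  = []
count≤0⇒∉ {u = u} (w ∷ us) h with w Fin.≟ u
... | yes _  = contradiction h (λ ())
... | no w≢u = (λ u≡w → w≢u (sym u≡w)) ∷ count≤0⇒∉ us h

count≤count-∷ : ∀ {n} (u w : Fin n) us → count u us ≤ count u (w ∷ us)
count≤count-∷ u w us with w Fin.≟ u
... | yes _ = n≤1+n _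
... | no _  = ≤-refl

-- A kept head exhausts its only permitted occurrence, so it is absent from the tail. The hypothesis
-- says `≤ 1` rather than `≡ 1` because only the inequality passes to tails.
filter-Unique : ∀ {n} {P : Fin n → Set} (P? : ∀ u → Dec (P u)) us →
                (∀ {u} → P u → count u us ≤ 1) → Unique (filter P? us)
filter-Unique P? []       _ = []
filter-Unique P? (u ∷ us) h with P? u | filter-Unique P? us (λ {w} pw → ≤-trans (count≤count-∷ w u us) (h pw))
... | yes pu | us! = All.filter⁺ P? (count≤0⇒∉ us u∉us) ∷ us!
  where
  u∉us : count u us ≤ 0
  u∉us = ≤-pred (subst (_≤ 1) (cong length (filter-accept (Fin._≟ u) refl)) (h pu))
... | no _   | us! = us!

-- Occurrences are counted in the whole level `us`, even when the predicate filters only the part of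
-- it that is still to be processed.
once? : ∀ {n} (us : List (Fin n)) (u : Fin n) → Dec (count u us ≡ 1)
once? us u = count u us ≟ 1

length-once≤ : ∀ {n} (us : List (Fin n)) → length (filter (once? us) us) ≤ n
length-once≤ us = Unique⇒length≤ (filter-Unique (once? us) us ≤-reflexive)

-- Invariants and costs of loops.

module _ {A S : Set} (J : S → List A → Set) {f : S → A → S}
         (step : ∀ s x xs → J s (x ∷ xs) → J (f s x) xs) where

  -- The invariant sees the elements still to come, so it can also express a budget that shrinks as
  -- they are consumed.
  foldl-invariant : ∀ {s} xs → J s xs → J (foldl f s xs) []
  foldl-invariant []       j = j
  foldl-invariant (x ∷ xs) j = foldl-invariant xs (step _ x xs j)

  forEachCost-≤ : ∀ {t : S → A → ℕ} {b} → (∀ s x xs → J s (x ∷ xs) → t s x ≤ b) →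
                  ∀ {s} xs → J s xs → forEachCost f t s xs ≤ length xs * suc b
  forEachCost-≤ t≤b []       j = z≤n
  forEachCost-≤ t≤b (x ∷ xs) j =
    s≤s (+-mono-≤ (t≤b _ x xs j) (forEachCost-≤ t≤b xs (step _ x xs j)))

module _ {S : Set} (J : ℕ → S → Set) {c : S → Bool} {f : S → S}
         (step : ∀ m s → J (suc m) s → J m (f s)) where

  -- Here `J` is indexed by the number of iterations left. The loop may stop early, so the final
  -- index is existential.
  whileVal-invariant : ∀ m {s} → J m s → ∃[ m′ ] J m′ (whileVal m c f s)
  whileVal-invariant zero    j = _ , j
  whileVal-invariant (suc m) {s} j with c s
  ... | true  = whileVal-invariant m (step m _ j)
  ... | false = _ , j

  whileCost-≤ : ∀ {tc tf : S → ℕ} {a b} →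
                (∀ m s → J (suc m) s → tc s ≤ a) → (∀ m s → J (suc m) s → tf s ≤ b) →
                ∀ m {s} → J m s → whileCost m c tc f tf s ≤ m * suc (a + b)
  whileCost-≤ tc≤a tf≤b zero    j = z≤n
  whileCost-≤ {a = a} {b} tc≤a tf≤b (suc m) {s} j with c s
  ... | true  = s≤s (≤-trans
    (+-mono-≤ (tc≤a m _ j) (+-mono-≤ (tf≤b m _ j) (whileCost-≤ tc≤a tf≤b m (step m _ j))))
    (≤-reflexive (sym (+-assoc a b _))))
  ... | false = s≤s (≤-trans (+-mono-≤ (tc≤a m _ j) z≤n)
    (≤-trans (≤-reflexive (+-identityʳ a)) (≤-trans (m≤m+n a b) (m≤m+n (a + b) _))))

if-preserves : {A : Set} (P : A → Set) → ∀ b {x y} → P x → P y → P (if b then x else y)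
if-preserves P true  px py = px
if-preserves P false px py = py

length-foldl-∷ : {A B : Set} (g : A → B) {ys : List B} (xs : List A) →
                 length (foldl (λ zs x → g x ∷ zs) ys xs) ≡ length ys + length xs
length-foldl-∷ g {ys} []       = sym (+-identityʳ _)
length-foldl-∷ g {ys} (x ∷ xs) =
  trans (length-foldl-∷ g xs) (sym (+-suc (length ys) (length xs)))

-- Positivity of `n` gives 1 ≤ n^k and makes n^k monotone in k, so that constants and lower powers
-- are absorbed by higher ones.
module Analysis {n : ℕ} ⦃ n≢0 : NonZero n ⦄ (G H : Graph n) where

  open Evaluation G H
  open Program {Val n} hiding (uniquenessTree) renaming (length to lengthᵗ; reverse to reverseᵗ)

  -- Arithmetic of bounds of the form c n^k.

  infix 4 _≤[_,_]

  -- A record, so that the coefficient and the exponent can be inferred from the type.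
  record _≤[_,_] (x c k : ℕ) : Set where
    constructor bounded
    field bound : x ≤ c * n ^ k

  open _≤[_,_]

  -- A record, since `cost e` unfolds and would no longer determine `e`, which the rules below leave
  -- to inference.
  record Cost (c k : ℕ) {τ : Ty} (e : Tm (Val n) τ) : Set where
    constructor costs
    field within : cost e ≤[ c , k ]

  open Cost

  raise : ∀ {x c j k} → j ≤ k → x ≤[ c , j ] → x ≤[ c , k ]
  raise {c = c} j≤k (bounded p) = bounded (≤-trans p (*-monoʳ-≤ c (^-monoʳ-≤ n j≤k)))

  -- Coefficients add and exponents take the maximum. On literals both are evaluated by type
  -- checking, so the numerals in the cost lemmas below are what the rules yield.
  sum-≤ : ∀ {x y c d j k} → x ≤[ c , j ] → y ≤[ d , k ] → x + y ≤[ c + d , j ⊔ k ]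
  sum-≤ {c = c} {d} {j} {k} p q = bounded (≤-trans
    (+-mono-≤ (bound (raise (m≤m⊔n j k) p)) (bound (raise (m≤n⊔m j k) q)))
    (≤-reflexive (sym (*-distribʳ-+ (n ^ (j ⊔ k)) c d))))

  suc-≤ : ∀ {x c k} → x ≤[ c , k ] → suc x ≤[ suc c , k ]
  suc-≤ {k = k} (bounded p) = bounded (+-mono-≤ (m^n>0 n k) p)

  product-≤ : ∀ {x y c d j k} → x ≤[ c , j ] → y ≤[ d , k ] → x * y ≤[ c * d , j + k ]
  product-≤ {c = c} {d} {j} {k} (bounded p) (bounded q) = bounded (≤-trans (*-mono-≤ p q)
    (≤-reflexive (trans ([m*n]*[o*p]≡[m*o]*[n*p] c (n ^ j) d (n ^ k))
      (cong (c * d *_) (sym (^-distribˡ-+-* n j k))))))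

  smaller : ∀ {x y c k} → x ≤ y → y ≤[ c , k ] → x ≤[ c , k ]
  smaller x≤y (bounded p) = bounded (≤-trans x≤y p)

  one : 1 ≤[ 1 , 0 ]
  one = bounded ≤-refl

  ≤n : ∀ {x} → x ≤ n → x ≤[ 1 , 1 ]
  ≤n x≤n = bounded (≤-trans x≤n (≤-reflexive (sym (trans (*-identityˡ _) (*-identityʳ n)))))

  ≤n² : ∀ {x} → x ≤ n * n → x ≤[ 1 , 2 ]
  ≤n² x≤ = smaller x≤ (product-≤ (≤n ≤-refl) (≤n ≤-refl))

  -- Cost rules for the constructs of the language.

  constant : ∀ {τ} {e : Tm (Val n) τ} → cost e ≡ 1 → Cost 1 0 e
  constant eq = costs (bounded (≤-reflexive eq))

  var-cost : ∀ {σ} {x : Val n σ} → Cost 1 0 (var x)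
  var-cost = constant refl

  bind-cost : ∀ {σ τ c d j k} {e : Tm (Val n) σ} {b : Val n σ → Tm (Val n) τ} →
              Cost c j e → Cost d k (b (val e)) → Cost (1 + c + d) (j ⊔ k) (bind e b)
  bind-cost p q = costs (suc-≤ (sum-≤ (within p) (within q)))

  fst-cost : ∀ {σ τ c k} {e : Tm (Val n) (σ ⊗ τ)} → Cost c k e → Cost (1 + c) k (fst e)
  fst-cost p = costs (suc-≤ (within p))

  snd-cost : ∀ {σ τ c k} {e : Tm (Val n) (σ ⊗ τ)} → Cost c k e → Cost (1 + c) k (snd e)
  snd-cost p = costs (suc-≤ (within p))

  succ-cost : ∀ {c k} {e : Tm (Val n) nat} → Cost c k e → Cost (1 + c) k (succ e)
  succ-cost p = costs (suc-≤ (within p))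

  prd-cost : ∀ {c k} {e : Tm (Val n) nat} → Cost c k e → Cost (1 + c) k (prd e)
  prd-cost p = costs (suc-≤ (within p))

  ==-cost : ∀ {c d j k} {e e′ : Tm (Val n) nat} →
            Cost c j e → Cost d k e′ → Cost (1 + c + d) (j ⊔ k) (e == e′)
  ==-cost p q = costs (suc-≤ (sum-≤ (within p) (within q)))

  ==ᵛ-cost : ∀ {c d j k} {e e′ : Tm (Val n) vertex} →
             Cost c j e → Cost d k e′ → Cost (1 + c + d) (j ⊔ k) (e ==ᵛ e′)
  ==ᵛ-cost p q = costs (suc-≤ (sum-≤ (within p) (within q)))

  adj-cost : ∀ {s c d j k} {e e′ : Tm (Val n) vertex} →
             Cost c j e → Cost d k e′ → Cost (1 + c + d) (j ⊔ k) (adj s e e′)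
  adj-cost p q = costs (suc-≤ (sum-≤ (within p) (within q)))

  pair-cost : ∀ {σ τ c d j k} {e : Tm (Val n) σ} {e′ : Tm (Val n) τ} →
              Cost c j e → Cost d k e′ → Cost (1 + c + d) (j ⊔ k) (pair e e′)
  pair-cost p q = costs (suc-≤ (sum-≤ (within p) (within q)))

  cons-cost : ∀ {σ c d j k} {e : Tm (Val n) σ} {e′ : Tm (Val n) (list σ)} →
              Cost c j e → Cost d k e′ → Cost (1 + c + d) (j ⊔ k) (cons e e′)
  cons-cost p q = costs (suc-≤ (sum-≤ (within p) (within q)))

  -- Both branches are charged, which makes the bound independent of the value of the test and
  -- leaves the exponent a maximum.
  cond-cost : ∀ {τ a c d i j k} {b : Tm (Val n) bool} {e e′ : Tm (Val n) τ} →
              Cost a i b → Cost c j e → Cost d k e′ →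
              Cost (1 + a + (c + d)) (i ⊔ (j ⊔ k)) (cond b e e′)
  cond-cost {b = b} {e} {e′} r p q =
    costs (suc-≤ (sum-≤ (within r) (smaller branch (sum-≤ (within p) (within q)))))
    where
    branch : (if val b then cost e else cost e′) ≤ cost e + cost e′
    branch = if-preserves (_≤ cost e + cost e′) (val b) (m≤m+n _ _) (m≤n+m _ _)

  and-cost : ∀ {c d j k} {b b′ : Tm (Val n) bool} → Cost c j b → Cost d k b′ →
             Cost (1 + c + (d + 1)) (j ⊔ (k ⊔ 0)) (b and b′)
  and-cost p q = cond-cost p q (constant refl)

  -- The equation handed to the last hypothesis lets facts about the matched list be transported to
  -- its head and tail. The branch not taken counts as 0 in the common bound.
  match-cost : ∀ {σ τ a c d i j k} {e : Tm (Val n) (list σ)} {z : Tm (Val n) τ}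
               {b : Val n σ → Val n (list σ) → Tm (Val n) τ} →
               Cost a i e → Cost c j z → (∀ x xs → val e ≡ x ∷ xs → Cost d k (b x xs)) →
               Cost (1 + a + (c + d)) (i ⊔ (j ⊔ k)) (match e z b)
  match-cost {c = c} {d} {j = j} {k} {e} {z} {b} r p q =
    costs (suc-≤ (sum-≤ (within r) (branch (val e) refl)))
    where
    branch : ∀ ys → val e ≡ ys →
             matchVal ys (cost z) (λ x xs → cost (b x xs)) ≤[ c + d , j ⊔ k ]
    branch []       _  = smaller (m≤m+n _ 0) (sum-≤ (within p) (bounded z≤n))
    branch (x ∷ xs) eq =
      sum-≤ {x = 0} (bounded z≤n) (within (q x xs eq))

  module _ {σ τ : Ty} {l d h k : ℕ} {z : Tm (Val n) τ}
           {b : Val n τ → Val n σ → Tm (Val n) τ}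
           (J : Val n τ → List (Val n σ) → Set)
           (step : ∀ s x xs → J s (x ∷ xs) → J (val (b s x)) xs) where

    iterations-cost : ∀ {xs} → length xs ≤[ l , h ] → J (val z) xs →
      (∀ s x xs → J s (x ∷ xs) → Cost d k (b s x)) →
      forEachCost (λ s x → val (b s x)) (λ s x → cost (b s x)) (val z) xs ≤[ l * suc d , h + k ]
    iterations-cost {xs} len start body = smaller
      (forEachCost-≤ J step (λ s x xs j → bound (within (body s x xs j))) xs start)
      (product-≤ len (suc-≤ (bounded ≤-refl)))

    forEach-cost : ∀ {a c i j} {e : Tm (Val n) (list σ)} → Cost a i e → Cost c j z →
      length (val e) ≤[ l , h ] → J (val z) (val e) →
      (∀ s x xs → J s (x ∷ xs) → Cost d k (b s x)) →
      Cost (1 + a + c + l * suc d) (i ⊔ j ⊔ (h + k)) (forEach e z b)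
    forEach-cost r p len start body =
      costs (suc-≤ (sum-≤ (sum-≤ (within r) (within p)) (iterations-cost len start body)))

  forEach-All-cost : ∀ {σ τ l a c d h i j k} {z : Tm (Val n) τ}
    {b : Val n τ → Val n σ → Tm (Val n) τ} (P : Val n σ → Set)
    {e : Tm (Val n) (list σ)} → Cost a i e → Cost c j z →
    length (val e) ≤[ l , h ] → All P (val e) →
    (∀ s x → P x → Cost d k (b s x)) →
    Cost (1 + a + c + l * suc d) (i ⊔ j ⊔ (h + k)) (forEach e z b)
  forEach-All-cost P r p len ps body =
    forEach-cost (λ _ → All P) (λ _ _ _ → All.tail) r p len ps (λ s x _ j → body s x (All.head j))

  forEach-any-cost : ∀ {σ τ l a c d h i j k} {z : Tm (Val n) τ}
    {b : Val n τ → Val n σ → Tm (Val n) τ}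
    {e : Tm (Val n) (list σ)} → Cost a i e → Cost c j z →
    length (val e) ≤[ l , h ] → (∀ s x → Cost d k (b s x)) →
    Cost (1 + a + c + l * suc d) (i ⊔ j ⊔ (h + k)) (forEach e z b)
  forEach-any-cost r p len body = forEach-cost (λ _ _ → ⊤) _ r p len _ (λ s x _ _ → body s x)

  forUpTo-cost : ∀ {τ l a c d h i j k} {z : Tm (Val n) τ}
    {b : Val n τ → ℕ → Tm (Val n) τ} {e : Tm (Val n) nat} →
    Cost a i e → Cost c j z → val e ≤[ l , h ] → (∀ s m → Cost d k (b s m)) →
    Cost (1 + a + c + l * suc d) (i ⊔ j ⊔ (h + k)) (forUpTo e z b)
  forUpTo-cost {z = z} {e = e} r p len body =
    costs (suc-≤ (sum-≤ (sum-≤ (within r) (within p))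
      (iterations-cost {z = z} (λ _ _ → ⊤) _ (smaller (≤-reflexive (length-upTo (val e))) len) _ (λ s m _ _ → body s m))))

  while-cost : ∀ {τ l a c d f g h i j k} {e : Tm (Val n) nat} {z : Tm (Val n) τ}
    {t : Val n τ → Tm (Val n) bool} {b : Val n τ → Tm (Val n) τ} (J : ℕ → Val n τ → Set) →
    (∀ m s → J (suc m) s → J m (val (b s))) →
    Cost a i e → Cost c j z → val e ≤[ l , h ] → J (val e) (val z) →
    (∀ m s → J (suc m) s → Cost d k (t s)) → (∀ m s → J (suc m) s → Cost f g (b s)) →
    Cost (1 + a + c + l * suc (d + f)) (i ⊔ j ⊔ (h + (k ⊔ g))) (while e z t b)
  while-cost {d = d} {f} {g} {k = k} {e} J step r p len start test body =
    costs (suc-≤ (sum-≤ (sum-≤ (within r) (within p)) (smaller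
      (whileCost-≤ J step (λ m s j → bound (within (test m s j))) (λ m s j → bound (within (body m s j))) (val e) start)
      (product-≤ len (suc-≤ (sum-≤ (bounded {c = d} {k} ≤-refl) (bounded {c = f} {g} ≤-refl)))))))

  -- Size bounds for nodes, levels, trees and forests.

  length-vertices : length (allFin n) ≤[ 1 , 1 ]
  length-vertices = ≤n (≤-reflexive (length-tabulate (λ v → v)))

  SmallNode : Val n node → Set
  SmallNode x = length (proj₂ x) ≤[ 1 , 1 ]

  SmallLevel : Val n level → Set
  SmallLevel l = length l ≤[ 1 , 2 ] × All SmallNode l

  -- The coefficient 2 covers up to `n` expanded levels and one final level of leaves: n + 1 ≤ 2n.
  SmallTree : Val n tree → Set
  SmallTree t = length t ≤[ 2 , 1 ] × All SmallLevel t

  -- The length is bounded by `n` itself, as the later count of pairs needs exact arithmetic.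
  SmallForest : Val n (list (vertex ⊗ tree)) → Set
  SmallForest ts = length ts ≤ n × All (SmallTree ∘ proj₂) ts

  -- Processing a single level.

  occurrences-cost : ∀ u us → length us ≤[ 1 , 2 ] → Cost 11 2 (occurrences u us)
  occurrences-cost u us len = forEach-any-cost var-cost (constant refl) len
    (λ _ _ → cond-cost (==ᵛ-cost var-cost var-cost) (succ-cost var-cost) var-cost)

  -- The counter plus the occurrences still to come is constant. This ties the uniqueness test of
  -- the program to `count`.
  occurrences-val : ∀ u us → val (occurrences u us) ≡ count u us
  occurrences-val u us = trans (sym (+-identityʳ _))
    (foldl-invariant (λ k ws → k + count u ws ≡ count u us) step us refl)
    where
    step : ∀ k w ws → k + count u (w ∷ ws) ≡ count u us →
           (if ⌊ w Fin.≟ u ⌋ then suc k else k) + count u ws ≡ count u us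
    step k w ws eq with w Fin.≟ u
    ... | yes _ = trans (sym (+-suc k (count u ws))) eq
    ... | no _  = eq

  member-cost : ∀ {a} u {us : Tm (Val n) (list vertex)} → Cost a 0 us →
                length (val us) ≤[ 1 , 2 ] → Cost (1 + a + 1 + 7) 2 (member u us)
  member-cost u p len = forEach-any-cost p (constant refl) len
    (λ _ _ → cond-cost (==ᵛ-cost var-cost var-cost) (constant refl) var-cost)

  unique-cost : ∀ u us → length us ≤[ 1 , 2 ] → Cost 14 2 (unique u us)
  unique-cost u us len = ==-cost (occurrences-cost u us len) (succ-cost (constant refl))

  someUnique-cost : ∀ us → length us ≤[ 1 , 2 ] → Cost 21 4 (someUnique us)
  someUnique-cost us len = forEach-any-cost var-cost (constant refl) len
    (λ _ u → cond-cost (unique-cost u us len) (constant refl) var-cost)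

  neighbours-cost : ∀ s u → Cost 12 1 (neighbours s u)
  neighbours-cost s u = forEach-any-cost (constant refl) (constant refl) length-vertices
    (λ _ _ → cond-cost (adj-cost var-cost var-cost) (cons-cost var-cost var-cost) var-cost)

  -- Each vertex contributes at most one entry, so the entries collected plus the vertices still to
  -- come never exceed `n`.
  neighbours-length : ∀ s u → length (val (neighbours s u)) ≤ n
  neighbours-length s u = ≤-trans (m≤m+n _ 0)
    (foldl-invariant (λ ws vs → length ws + length vs ≤ n) step (allFin n)
      (≤-reflexive (length-tabulate (λ v → v))))
    where
    step : ∀ ws v (vs : List (Fin n)) → length ws + suc (length vs) ≤ n →
           length (if adjacent (graph s) u v then v ∷ ws else ws) + length vs ≤ n
    step ws v vs h with adjacent (graph s) u v
    ... | true  = subst (_≤ n) (+-suc (length ws) (length vs)) h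
    ... | false = ≤-trans (+-monoʳ-≤ (length ws) (n≤1+n _)) h

  expand-cost : ∀ s us → length us ≤[ 1 , 2 ] → Cost 36 4 (expand s us)
  expand-cost s us len = forEach-any-cost var-cost (constant refl) len
    (λ _ u → cons-cost (pair-cost var-cost
      (cond-cost (unique-cost u us len) (neighbours-cost s u) (constant refl))) var-cost)

  total : Val n level → ℕ
  total l = sum (map (length ∘ proj₂) l)

  children : Side → List (Fin n) → Fin n → List (Fin n)
  children s us u = if val (unique u us) then val (neighbours s u) else []

  children-length : ∀ s us u → length (children s us u) ≤ n
  children-length s us u =
    if-preserves (λ ws → length ws ≤ n) (val (unique u us)) (neighbours-length s u) z≤n

  -- Amortisation: a unique node spends one credit of `n`, which pays for its at most `n` children;
  -- any other node spends nothing and has none.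
  children-budget : ∀ s us u ws → length (children s us u) + n * length (filter (once? us) ws)
                                  ≤ n * length (filter (once? us) (u ∷ ws))
  -- The rewrite turns the test in `children` into the decision of `count u us ≡ 1` that underlies
  -- `once?`.
  children-budget s us u ws rewrite occurrences-val u us with count u us ≟ 1
  ... | yes once rewrite filter-accept (once? us) {xs = ws} once =
    ≤-trans (+-monoˡ-≤ _ (neighbours-length s u)) (≤-reflexive (sym (*-suc n _)))
  ... | no ¬once rewrite filter-reject (once? us) {xs = ws} ¬once = ≤-refl

  -- Children produced so far plus `n` for each unique node still to come stay within n²: at the
  -- start there are at most `n` unique nodes, and `children-budget` keeps the balance.
  expand-total : ∀ s us → total (val (expand s us)) ≤ n * n
  expand-total s us = ≤-trans (m≤m+n _ _)
    (foldl-invariant (λ ns ws → total ns + n * length (filter (once? us) ws) ≤ n * n)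
      (λ ns u ws h → ≤-trans (step ns u ws) h) us (*-monoʳ-≤ n (length-once≤ us)))
    where
    step : ∀ ns u ws → length (children s us u) + total ns + n * length (filter (once? us) ws)
                       ≤ total ns + n * length (filter (once? us) (u ∷ ws))
    step ns u ws = ≤-trans
      (≤-reflexive (trans (cong (_+ n * length (filter (once? us) ws)) (+-comm (length (children s us u)) (total ns)))
        (+-assoc (total ns) (length (children s us u)) _)))
      (+-monoʳ-≤ (total ns) (children-budget s us u ws))

  expand-small : ∀ s us → length us ≤[ 1 , 2 ] → SmallLevel (val (expand s us))
  expand-small s us len =
    smaller (≤-reflexive (length-foldl-∷ (λ u → u , children s us u) us)) len ,
    foldl-invariant (λ ns _ → All SmallNode ns)
      (λ _ u _ small → ≤n (children-length s us u) ∷ small) us []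

  childLabels-cost : ∀ l → SmallLevel l → Cost 12 3 (childLabels l)
  childLabels-cost l (len , small) = forEach-All-cost SmallNode var-cost (constant refl) len small
    (λ _ _ lenₓ → forEach-any-cost (snd-cost var-cost) var-cost lenₓ
      (λ _ _ → cons-cost var-cost var-cost))

  childLabels-length : ∀ l → length (val (childLabels l)) ≡ total l
  childLabels-length l = trans (sym (+-identityʳ _))
    (foldl-invariant (λ ws xs → length ws + total xs ≡ total l)
      (λ ws x xs eq → trans (cong (_+ total xs) (length-foldl-∷ (λ w → w) (proj₂ x)))
        (trans (+-assoc (length ws) _ _) eq)) l refl)

  leaves-cost : ∀ us → length us ≤[ 1 , 2 ] → Cost 9 2 (leaves us)
  leaves-cost us len = forEach-any-cost var-cost (constant refl) len
    (λ _ _ → cons-cost (pair-cost var-cost (constant refl)) var-cost)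

  leaves-small : ∀ us → length us ≤[ 1 , 2 ] → SmallLevel (val (leaves us))
  leaves-small us len =
    smaller (≤-reflexive (length-foldl-∷ (λ u → u , []) us)) len ,
    foldl-invariant (λ ns _ → All SmallNode ns) (λ _ _ _ small → bounded z≤n ∷ small) us []

  -- Generation of the trees.

  -- Loop invariant with `m` iterations left: it caps the number of completed levels by `n` and
  -- keeps the current level within n² nodes.
  Growing : ℕ → Val n (tree ⊗ list vertex) → Set
  Growing m (ls , us) = length ls + m ≤ n × All SmallLevel ls × length us ≤[ 1 , 2 ]

  -- `grow`, `growTree` and `complete` are the pieces of `generateTree`, named so that statements
  -- can refer to their values.
  grow : Side → Val n (tree ⊗ list vertex) → Tm (Val n) (tree ⊗ list vertex)
  grow s st = us ← snd (var st) ⨾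
              l  ← expand s us ⨾
              pair (cons (var l) (fst (var st))) (childLabels l)

  growTree : Side → Fin n → Tm (Val n) (tree ⊗ list vertex)
  growTree s v = while size (pair nil (cons (var v) nil))
                   (λ st → us ← snd (var st) ⨾ someUnique us) (grow s)

  Growing-start : ∀ v → Growing n ([] , v ∷ [])
  Growing-start v = ≤-refl , [] , raise z≤n one

  -- The bound on the new level comes from `expand-total`, whatever the size of the old level, so it
  -- does not deteriorate over the iterations.
  Growing-step : ∀ s m st → Growing (suc m) st → Growing m (val (grow s st))
  Growing-step s m (ls , us) (height , small , len) =
    subst (_≤ n) (+-suc (length ls) m) height ,
    expand-small s us len ∷ small ,
    ≤n² (≤-trans (≤-reflexive (childLabels-length (val (expand s us)))) (expand-total s us))

  grow-cost : ∀ s {m} st → Growing m st → Cost 57 4 (grow s st)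
  grow-cost s (_ , us) (_ , _ , len) = bind-cost (snd-cost var-cost) (bind-cost (expand-cost s us len)
    (pair-cost (cons-cost var-cost (fst-cost var-cost)) (childLabels-cost _ (expand-small s us len))))

  growTree-cost : ∀ s v → Cost 89 5 (growTree s v)
  growTree-cost s v = while-cost {f = 57} Growing (Growing-step s)
    (constant refl) (pair-cost (constant refl) (cons-cost var-cost (constant refl)))
    (≤n ≤-refl) (Growing-start v)
    (λ { _ (_ , us) (_ , _ , len) → bind-cost (snd-cost var-cost) (someUnique-cost us len) })
    (λ _ → grow-cost s)

  growTree-Growing : ∀ s v → ∃[ m ] Growing m (val (growTree s v))
  growTree-Growing s v = whileVal-invariant Growing (Growing-step s) n (Growing-start v)

  complete : Val n (tree ⊗ list vertex) → Tm (Val n) tree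
  complete st = us ← snd (var st) ⨾
    match (var us) (fst (var st)) (λ _ _ → cons (leaves us) (fst (var st)))

  complete-cost : ∀ {m} st → Growing m st → Cost 19 2 (complete st)
  complete-cost (_ , us) (_ , _ , len) = bind-cost (snd-cost var-cost)
    (match-cost var-cost (fst-cost var-cost)
      (λ _ _ _ → cons-cost (leaves-cost us len) (fst-cost var-cost)))

  complete-small : ∀ {m} st → Growing m st → SmallTree (val (complete st))
  complete-small (ls , []) (height , small , _) =
    -- No level of leaves is added here; the extra one only reaches the bound shared with the other
    -- case.
    smaller (n≤1+n _) (suc-≤ (≤n (≤-trans (m≤m+n _ _) height))) , small
  complete-small (ls , us@(_ ∷ _)) (height , small , len) =
    suc-≤ (≤n (≤-trans (m≤m+n _ _) height)) , leaves-small us len ∷ small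

  generateTree-cost : ∀ s v → Cost 109 5 (generateTree s v)
  generateTree-cost s v =
    bind-cost (growTree-cost s v) (complete-cost (val (growTree s v)) (proj₂ (growTree-Growing s v)))

  generateTree-small : ∀ s v → SmallTree (val (generateTree s v))
  generateTree-small s v = complete-small (val (growTree s v)) (proj₂ (growTree-Growing s v))

  reverse-vertices-length : length (val (reverseᵗ vertices)) ≡ n
  reverse-vertices-length =
    trans (length-foldl-∷ (λ v → v) (allFin n)) (length-tabulate (λ v → v))

  generateTrees-cost : ∀ s → Cost 125 6 (generateTrees s)
  generateTrees-cost s = bind-cost
    (forEach-any-cost (constant refl) (constant refl) length-vertices
      (λ _ _ → cons-cost var-cost var-cost))
    (forEach-any-cost {l = 1} {d = 113} var-cost (constant refl) (≤n (≤-reflexive reverse-vertices-length))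
      (λ _ v → cons-cost (pair-cost var-cost (generateTree-cost s v)) var-cost))

  generateTrees-small : ∀ s → SmallForest (val (generateTrees s))
  generateTrees-small s =
    ≤-reflexive (trans (length-foldl-∷ (λ v → v , val (generateTree s v)) (val (reverseᵗ vertices)))
      reverse-vertices-length) ,
    foldl-invariant (λ ts _ → All (SmallTree ∘ proj₂) ts)
      (λ _ v _ small → generateTree-small s v ∷ small) (val (reverseᵗ vertices)) []

  -- Comparison of two trees.

  length-cost : ∀ {σ a c i k} {xs : Tm (Val n) (list σ)} → Cost a i xs →
                length (val xs) ≤[ c , k ] → Cost (1 + a + 1 + c * 3) (i ⊔ 0 ⊔ (k + 0)) (lengthᵗ xs)
  length-cost p len = forEach-any-cost p (constant refl) len (λ _ _ → succ-cost var-cost)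

  withChildren-cost : ∀ i l → SmallLevel l → Cost 17 3 (withChildren i l)
  withChildren-cost i l (len , small) = forEach-All-cost SmallNode var-cost (constant refl) len small
    (λ _ _ lenₓ → cond-cost (==-cost (length-cost (snd-cost var-cost) lenₓ) var-cost)
      (succ-cost var-cost) var-cost)

  sameLevel-cost : ∀ l m → SmallLevel l → SmallLevel m → Cost 61 4 (sameLevel l m)
  sameLevel-cost l m small-l small-m = and-cost
    (==-cost (length-cost var-cost (proj₁ small-l)) (length-cost var-cost (proj₁ small-m)))
    (forUpTo-cost (prd-cost (constant refl)) (constant refl) (≤n pred[n]≤n)
      (λ _ j → bind-cost (succ-cost var-cost) (and-cost var-cost
        (==-cost (withChildren-cost (suc j) l small-l) (withChildren-cost (suc j) m small-m)))))

  -- The invariant follows two lists consumed in step: the levels of `t` still to come, and those of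
  -- `t′` held in the state.
  sameLevels-cost : ∀ t t′ → SmallTree t → SmallTree t′ → Cost 154 5 (sameLevels t t′)
  sameLevels-cost t t′ (len , small) (_ , small′) = snd-cost
    (forEach-cost (λ st ls → All SmallLevel (proj₁ st) × All SmallLevel ls) step
      var-cost (pair-cost var-cost (constant refl)) len (small′ , small)
      (λ { _ l _ (rest , small-l ∷ _) → match-cost (fst-cost var-cost) (pair-cost (constant refl) (constant refl))
        (λ m ms eq → pair-cost var-cost (and-cost (snd-cost var-cost)
          -- The matched level `m` is small because the equation `eq` identifies it as the head of
          -- the list held in the state.
          (sameLevel-cost l m small-l (All.head (subst (All SmallLevel) eq rest))))) }))
    where
    step : ∀ st l ls → All SmallLevel (proj₁ st) × All SmallLevel (l ∷ ls) →
           All SmallLevel (proj₁ (matchVal (proj₁ st) ([] , false)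
             (λ m ms → ms , (if proj₂ st then val (sameLevel l m) else false)))) × All SmallLevel ls
    step ([] , _)    _ _ (_ , _ ∷ small)        = [] , small
    step (_ ∷ _ , _) _ _ (_ ∷ rest , _ ∷ small) = rest , small

  equivalent-cost : ∀ t t′ → SmallTree t → SmallTree t′ → Cost 175 5 (equivalent t t′)
  equivalent-cost t t′ small small′ = and-cost
    (==-cost (length-cost var-cost (proj₁ small)) (length-cost var-cost (proj₁ small′)))
    (sameLevels-cost t t′ small small′)

  -- Comparison of all pairs of trees.

  -- r is the number of pairs still to be compared; each of them adds at most one
  -- entry, so that the n² pairs bound the lists without showing them repetition-free.
  Mapped : Val n (list vertex ⊗ list vertex) → ℕ → Set
  Mapped (vs , us) r = length vs + r ≤ n * n × length us + r ≤ n * n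

  Mapped-skip : ∀ st {r} → Mapped st (suc r) → Mapped st r
  Mapped-skip (vs , us) (p , q) =
    ≤-trans (+-monoʳ-≤ (length vs) (n≤1+n _)) p , ≤-trans (+-monoʳ-≤ (length us) (n≤1+n _)) q

  Mapped-add : ∀ vs us v u {r} → Mapped (vs , us) (suc r) → Mapped (v ∷ vs , u ∷ us) r
  Mapped-add vs us _ _ {r} (p , q) =
    subst (_≤ n * n) (+-suc (length vs) r) p , subst (_≤ n * n) (+-suc (length us) r) q

  comparePair : Val n (vertex ⊗ tree) → Val n (list vertex ⊗ list vertex) →
                Val n (vertex ⊗ tree) → Tm (Val n) (list vertex ⊗ list vertex)
  comparePair x st y =
    v ← fst (var x) ⨾
    u ← fst (var y) ⨾
    t ← snd (var x) ⨾
    t′ ← snd (var y) ⨾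
    cond (member v (fst (var st))) (var st)
      (cond (member u (snd (var st))) (var st)
        (cond (equivalent t t′)
          (pair (cons (var v) (fst (var st))) (cons (var u) (snd (var st))))
          (var st)))

  -- Membership in lists of at most n² entries costs O(n²), which is dominated by the O(n⁵) of the
  -- equivalence test.
  comparePair-cost : ∀ x st y {r} → Mapped st r → SmallTree (proj₂ x) → SmallTree (proj₂ y) →
                     Cost 224 5 (comparePair x st y)
  comparePair-cost (v , t) (vs , us) (u , t′) (p , q) small small′ =
    bind-cost (fst-cost var-cost) (bind-cost (fst-cost var-cost)
      (bind-cost (snd-cost var-cost) (bind-cost (snd-cost var-cost)
        (cond-cost (member-cost v (fst-cost var-cost) (≤n² (≤-trans (m≤m+n _ _) p))) var-cost
          (cond-cost (member-cost u (snd-cost var-cost) (≤n² (≤-trans (m≤m+n _ _) q))) var-cost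
            (cond-cost (equivalent-cost t t′ small small′)
              (pair-cost (cons-cost var-cost (fst-cost var-cost)) (cons-cost var-cost (snd-cost var-cost)))
              var-cost))))))

  comparePair-mapped : ∀ x st y {r} → Mapped st (suc r) → Mapped (val (comparePair x st y)) r
  comparePair-mapped (v , t) st (u , t′) {r} h =
    if-preserves P (val (member v (fst (var st)))) skip
      (if-preserves P (val (member u (snd (var st)))) skip
        (if-preserves P (val (equivalent t t′)) (Mapped-add (proj₁ st) (proj₂ st) v u h) skip))
    where
    P : Val n (list vertex ⊗ list vertex) → Set
    P st′ = Mapped st′ r
    skip : Mapped st r
    skip = Mapped-skip st h

  module _ {ts′ : Val n (list (vertex ⊗ tree))} (small′ : SmallForest ts′) where

    -- The pairs left are those of the current row, counted by `length ys`, and the `r` pairs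
    -- reserved for later rows.
    RowState : ℕ → Val n (list vertex ⊗ list vertex) → Val n (list (vertex ⊗ tree)) → Set
    RowState r st ys = Mapped st (length ys + r) × All (SmallTree ∘ proj₂) ys

    RowState-step : ∀ x {r} st y ys → RowState r st (y ∷ ys) → RowState r (val (comparePair x st y)) ys
    RowState-step x st y _ (h , _ ∷ small) = comparePair-mapped x st y h , small

    RowState-start : ∀ {r} st → Mapped st (n + r) → RowState r st ts′
    RowState-start {r} (vs , us) (p , q) =
      (≤-trans (+-monoʳ-≤ (length vs) len) p , ≤-trans (+-monoʳ-≤ (length us) len) q) , proj₂ small′
      where
      len : length ts′ + r ≤ n + r
      len = +-monoˡ-≤ r (proj₁ small′)

    compareRow : Val n (list vertex ⊗ list vertex) → Val n (vertex ⊗ tree) →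
                 Tm (Val n) (list vertex ⊗ list vertex)
    compareRow st x = forEach (var ts′) (var st) (comparePair x)

    compareRow-cost : ∀ st x {r} → Mapped st (n + r) → SmallTree (proj₂ x) → Cost 228 6 (compareRow st x)
    compareRow-cost st x {r} h small = forEach-cost (RowState r) (RowState-step x)
      var-cost var-cost (≤n (proj₁ small′)) (RowState-start st h)
      (λ { st′ y _ (h′ , small-y ∷ _) → comparePair-cost x st′ y h′ small small-y })

    TableState : Val n (list vertex ⊗ list vertex) → Val n (list (vertex ⊗ tree)) → Set
    TableState st xs = Mapped st (length xs * n) × All (SmallTree ∘ proj₂) xs

    TableState-step : ∀ st x xs → TableState st (x ∷ xs) → TableState (val (compareRow st x)) xs
    TableState-step st x xs (h , _ ∷ small) =
      -- `length (x ∷ xs) * n` unfolds to `n + length xs * n`: the share of this row plus the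
      -- reserve for the later ones.
      proj₁ (foldl-invariant (RowState (length xs * n)) (RowState-step x) ts′ (RowState-start st h)) , small

    TableState-start : ∀ ts → SmallForest ts → TableState ([] , []) ts
    TableState-start _ (len , small) = (*-monoˡ-≤ n len , *-monoˡ-≤ n len) , small

    compareTrees-cost : ∀ ts → SmallForest ts → Cost 234 7 (compareTrees ts ts′)
    compareTrees-cost ts small = forEach-cost TableState TableState-step
      var-cost (pair-cost (constant refl) (constant refl)) (≤n (proj₁ small)) (TableState-start ts small)
      (λ { st x _ (h , small-x ∷ _) → compareRow-cost st x h small-x })

    compareTrees-mapped : ∀ ts → SmallForest ts → Mapped (val (compareTrees ts ts′)) 0
    compareTrees-mapped ts small =
      proj₁ (foldl-invariant TableState TableState-step ts (TableState-start ts small))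

  -- The total running time.

  allVertices-cost : ∀ us → length us ≤[ 1 , 2 ] → Cost 17 3 (allVertices us)
  allVertices-cost us len = forEach-any-cost (constant refl) (constant refl) length-vertices
    (λ _ v → and-cost var-cost (member-cost v var-cost len))

  -- The exponent is that of `compareTrees`; generation contributes exponent 6 and the final check
  -- 3. The coefficient is 125 + 125 + 234 for the main stages, and 45 for the final check and the
  -- bindings.
  uniquenessTree-cost : Cost 529 7 uniquenessTree
  uniquenessTree-cost =
    bind-cost (generateTrees-cost left) (bind-cost (generateTrees-cost right)
      (bind-cost (compareTrees-cost small-right _ small-left)
        (bind-cost (fst-cost var-cost) (bind-cost (snd-cost var-cost)
          (and-cost (allVertices-cost _ (≤n² (≤-trans (m≤m+n _ _) (proj₁ mapped))))
                    (allVertices-cost _ (≤n² (≤-trans (m≤m+n _ _) (proj₂ mapped)))))))))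
    where
    small-left : SmallForest (val (generateTrees left))
    small-left = generateTrees-small left
    small-right : SmallForest (val (generateTrees right))
    small-right = generateTrees-small right
    mapped : Mapped (val (compareTrees (val (generateTrees left)) (val (generateTrees right)))) 0
    mapped = compareTrees-mapped small-right _ small-left

  runningTime-≤ : runningTime G H ≤ 529 * n ^ 7
  runningTime-≤ = bound (within uniquenessTree-cost)

theorem1 : ∃[ C ] ∃[ n₀ ] (∀ (n : ℕ) → n₀ ≤ n → (G H : Graph n) → runningTime G H ≤ C * n ^ 7)
-- The threshold is 1 because at `n = 0` the right-hand side vanishes, while every evaluation costs
-- at least one unit.
theorem1 = 529 , 1 , λ n 1≤n G H → Analysis.runningTime-≤ ⦃ >-nonZero 1≤n ⦄ G H
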